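{- For integers $0\le a<b$ let $\Delta^{(odd)}_3([a,b))$ denote the number of odd evil integers in $[a,b)$ divisible by $3$ minus the number of odd odious integers in $[a,b)$ divisible by $3$. Then: 1) $\Delta^{(odd)}_3([0,2^n))=3^{\lfloor n/2\rfloor-1}$ for all integers $n\ge 2$. 2) For integers $n,m$: $$\Delta^{(odd)}_3([2^n,2^n+2^m))=\begin{cases}0, & n \text{ and } m \text{ even},\ 2\le m\le n-2,\\ 3^{\frac{m-2}{2}}, & n \text{ odd},\ m \text{ even},\ 2\le m\le n-1,\\ -3^{\frac{m-3}{2}}, & n \text{ even},\ m \text{ odd},\ 3\le m\le n-1,\\ 2\cdot 3^{\frac{m-3}{2}}, & n \text{ and } m \text{ odd},\ 3\le m\le n-2.\end{cases}$$ 3) For integers $n,m$: $$\Delta^{(odd)}_3([2^n+2^{n-2},\,2^n+2^{n-2}+2^m))=\begin{cases}-3^{\frac{m-2}{2}}, & n \text{ and } m \text{ even},\ 2\le m\le n-4,\\ 0, & n \text{ odd},\ m \text{ even},\ 2\le m\le n-3,\\ -2\cdot 3^{\frac{m-3}{2}}, & n \text{ even},\ m \text{ odd},\ 3\le m\le n-3,\\ 3^{\frac{m-3}{2}}, & n \text{ and } m \text{ odd},\ 3\le m\le n-4.\end{cases}$$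
   Context: A nonnegative integer is called evil if its binary expansion contains an even number of 1's, and odious if it contains an odd number of 1's; in particular $0$ is evil. An interval $[a,b)$ means the set of integers $x$ with $a\le x<b$. -}

module Defs where

open import Data.Digit using (toDigits; 1b)
open import Data.Fin.Properties using (_≟_)
open import Data.Integer.Base as ℤ using (ℤ; +_)
open import Data.List.Base using (List; length; filter; upTo)
open import Data.Nat.Base using (ℕ)
open import Data.Nat.Divisibility using (_∣_; _∤_; _∣?_)
open import Data.Nat.Properties using (_≤?_)
open import Data.Product.Base using (_×_; proj₁)
open import Relation.Nullary.Decidable using (¬?; _×-dec_)
open import Relation.Unary using (Pred; Decidable)
open import Level using (0ℓ)

Even Odd : Pred ℕ 0ℓ
Even n = 2 ∣ n
Odd  n = 2 ∤ n

even? : Decidable Even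
even? n = 2 ∣? n

odd? : Decidable Odd
odd? n = ¬? (even? n)

binaryOnes : ℕ → ℕ
binaryOnes n = length (filter (_≟ 1b) (proj₁ (toDigits 2 n)))

Evil Odious : Pred ℕ 0ℓ
Evil   n = Even (binaryOnes n)
Odious n = Odd (binaryOnes n)

evil? : Decidable Evil
evil? n = even? (binaryOnes n)

odious? : Decidable Odious
odious? n = odd? (binaryOnes n)

-- The half-open interval [a , b), as a list without repetitions.
[_,_⟩ : ℕ → ℕ → List ℕ
[ a , b ⟩ = filter (a ≤?_) (upTo b)

OddEvil₃ OddOdious₃ : Pred ℕ 0ℓ
OddEvil₃   x = Odd x × Evil x × 3 ∣ x
OddOdious₃ x = Odd x × Odious x × 3 ∣ x

oddEvil₃? : Decidable OddEvil₃
oddEvil₃? x = odd? x ×-dec evil? x ×-dec 3 ∣? x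

oddOdious₃? : Decidable OddOdious₃
oddOdious₃? x = odd? x ×-dec odious? x ×-dec 3 ∣? x

Δ₃ᵒᵈᵈ : List ℕ → ℤ
Δ₃ᵒᵈᵈ xs = + length (filter oddEvil₃? xs) ℤ.- + length (filter oddOdious₃? xs)

{-# OPTIONS --safe #-}
-- Let τ(x) = ±1 according to whether x is evil or odious, so that τ(2y) = τ(y)
-- and τ(2y+1) = −τ(y).  Call ⟨p,q,r⟩ the function that multiplies τ(x) by p, q
-- or r according to x mod 3.  Pairing 2y with 2y+1, a sum of ⟨p,q,r⟩ over
-- [2a, 2b) becomes the sum of ⟨p−q, r−p, q−r⟩ over [a, b), and Δ₃ᵒᵈᵈ [2a, 2b)
-- becomes the sum of ⟨0,−1,0⟩ over [a, b).  The orbit of the latter weight is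
--   ⟨0,−1,0⟩ ↦ ⟨1,0,−1⟩ ↦ ⟨1,−2,1⟩ ↦ 3⟨1,0,−1⟩ ↦ …
-- so Δ₃ᵒᵈᵈ of a dyadic block [2ᵐa, 2ᵐ(a+1)) is a power of 3 times a value at a
-- of ⟨1,0,−1⟩ (m even) or ⟨1,−2,1⟩ (m odd).  Every interval of the theorem is
-- such a block, with a = 0, a = 2ᵈ or a = 5·2ᵈ.
module Submission where

open import Defs
open import Data.Digit using (Expansion; fromDigits; toDigits; 0b; 1b)
open import Data.Empty using (⊥-elim)
open import Data.Fin.Base using (zero; suc)
open import Data.Fin.Properties using (_≟_)
open import Data.Integer.Base as ℤ using (ℤ; +_)
import Data.Integer.Properties as ℤ
open import Data.Integer.Tactic.RingSolver using (solve-∀)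
open import Data.List.Base using (List; []; _∷_; _++_; length; filter; upTo; applyUpTo; iterate)
open import Data.List.Properties using (filter-++; filter-all; filter-none; filter-accept; filter-reject; length-++)
open import Data.List.Relation.Unary.All using (All; []; _∷_)
open import Data.Nat.Base using (ℕ; zero; suc; _+_; _∸_; _*_; _^_; _/_; _≤_; _≰_; _<_; s≤s; s≤s⁻¹; ⌊_/2⌋)
open import Data.Nat.Divisibility using (_∣_; _∤_; divides; _∣?_; n∣m*n; ∣m+n∣m⇒∣n; ∣m∣n⇒∣m+n; ∣-refl; _∣0)
open import Data.Nat.DivMod using (m*n/n≡m)
open import Data.Nat.Properties hiding (_≟_)
import Data.Nat.Tactic.RingSolver as ℕ-Solver
open import Data.Product.Base using (_×_; _,_; ∃; proj₁; proj₂)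
open import Data.Sum.Base using (_⊎_; inj₁; inj₂)
open import Function.Base using (_∘_; id)
open import Level using (0ℓ)
open import Relation.Binary.PropositionalEquality using (_≡_; _≢_; refl; sym; trans; cong; cong₂; subst; module ≡-Reasoning)
open import Relation.Nullary.Decidable using (Dec; yes; no)
open import Relation.Nullary.Negation using (¬_)
open import Relation.Unary using (Pred; Decidable)
open ≡-Reasoning

-- Parity

m*2≢1+n*2 : ∀ m n → m * 2 ≢ suc (n * 2)
m*2≢1+n*2 (suc m) (suc n) eq = m*2≢1+n*2 m n (suc-injective (suc-injective eq))

odd-1+n*2 : ∀ n → Odd (suc (n * 2))
odd-1+n*2 n (divides q eq) = m*2≢1+n*2 q n (sym eq)

parity : ∀ n → (∃ λ k → n ≡ k * 2) ⊎ (∃ λ k → n ≡ suc (k * 2))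
parity zero = inj₁ (0 , refl)
parity (suc n) with parity n
... | inj₁ (k , eq) = inj₂ (k , cong suc eq)
... | inj₂ (k , eq) = inj₁ (suc k , cong suc eq)

Even⇒*2 : ∀ {n} → Even n → ∃ λ k → n ≡ k * 2
Even⇒*2 (divides k eq) = k , eq

Odd⇒1+*2 : ∀ {n} → Odd n → ∃ λ k → n ≡ suc (k * 2)
Odd⇒1+*2 {n} odd with parity n
... | inj₁ (k , eq) = ⊥-elim (odd (divides k eq))
... | inj₂ p        = p

Even-2+⁻ : ∀ {n} → Even (2 + n) → Even n
Even-2+⁻ e = ∣m+n∣m⇒∣n e ∣-refl

Odd-2+⁻ : ∀ {n} → Odd (2 + n) → Odd n
Odd-2+⁻ o e = o (∣m∣n⇒∣m+n ∣-refl e)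

*2-≤⇒+ : ∀ {i j} → j * 2 ≤ i * 2 → ∃ λ t → i * 2 ≡ t * 2 + j * 2
*2-≤⇒+ {i} {j} j≤i = i ∸ j ,
  trans (cong (_* 2) (sym (m∸n+n≡m (*-cancelʳ-≤ j i 2 j≤i)))) (*-distribʳ-+ 2 (i ∸ j) j)

-- These four lemmas write `n` as `d + m` with the parity of `d` visible. Only that parity matters
-- later, since multiplying by `2 ^ d` fixes the nonzero residues mod 3 or exchanges them
-- accordingly.
even∸even : ∀ {n m} → Even n → Even m → m ≤ n → ∃ λ t → n ≡ t * 2 + m
even∸even en em m≤n with Even⇒*2 en | Even⇒*2 em
... | i , refl | j , refl = *2-≤⇒+ {i} {j} m≤n

odd∸odd : ∀ {n m} → Odd n → Odd m → m ≤ n → ∃ λ t → n ≡ t * 2 + m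
odd∸odd on om m≤n with Odd⇒1+*2 on | Odd⇒1+*2 om
... | i , refl | j , refl with *2-≤⇒+ {i} {j} (s≤s⁻¹ m≤n)
...   | t , eq = t , trans (cong suc eq) (sym (+-suc (t * 2) (j * 2)))

even∸odd : ∀ {n m} → Even n → Odd m → m < n → ∃ λ t → n ≡ suc (t * 2) + m
even∸odd en om m<n with Even⇒*2 en | Odd⇒1+*2 om
-- For `m = suc (j * 2)` the hypothesis `m < n` computes to `suc j * 2 ≤ i * 2`.
... | i , refl | j , refl with *2-≤⇒+ {i} {suc j} m<n
...   | t , eq = t , trans eq (+-suc (t * 2) (suc (j * 2)))

odd∸even : ∀ {n m} → Odd n → Even m → m < n → ∃ λ t → n ≡ suc (t * 2) + m
odd∸even on em m<n with Odd⇒1+*2 on | Even⇒*2 em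
... | i , refl | j , refl with *2-≤⇒+ {i} {j} (s≤s⁻¹ m<n)
...   | t , eq = t , cong suc eq

2*m*n≡m*n*2 : ∀ m n → 2 * m * n ≡ m * n * 2
2*m*n≡m*n*2 m n = trans (*-assoc 2 m n) (*-comm 2 (m * n))

-- The Thue–Morse sign

ones : Expansion 2 → ℕ
ones ds = length (filter (_≟ 1b) ds)

-- Expansions of the same number may still differ in trailing zeros.
ones-unique : ∀ ds es → fromDigits ds ≡ fromDigits es → ones ds ≡ ones es
ones-unique []              []              eq = refl
ones-unique []              (zero ∷ es)     eq = ones-unique [] es (*-cancelʳ-≡ 0 (fromDigits es) 2 eq)
ones-unique (zero ∷ ds)     []              eq = ones-unique ds [] (*-cancelʳ-≡ (fromDigits ds) 0 2 eq)
ones-unique (zero ∷ ds)     (zero ∷ es)     eq = ones-unique ds es (*-cancelʳ-≡ (fromDigits ds) (fromDigits es) 2 eq)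
ones-unique (zero ∷ ds)     (suc zero ∷ es) eq = ⊥-elim (m*2≢1+n*2 (fromDigits ds) (fromDigits es) eq)
ones-unique (suc zero ∷ ds) (zero ∷ es)     eq = ⊥-elim (m*2≢1+n*2 (fromDigits es) (fromDigits ds) (sym eq))
ones-unique (suc zero ∷ ds) (suc zero ∷ es) eq =
  cong suc (ones-unique ds es (*-cancelʳ-≡ (fromDigits ds) (fromDigits es) 2 (suc-injective eq)))

-- The digits that `toDigits` produces for `n * 2` or `suc (n * 2)` need not be known: the digits of
-- `n` with `0b` or `1b` put in front have the right value, hence the right number of ones.
binaryOnes-fromDigits : ∀ n ds → fromDigits ds ≡ n → binaryOnes n ≡ ones ds
binaryOnes-fromDigits n ds eq =
  ones-unique (proj₁ (toDigits 2 n)) ds (trans (proj₂ (toDigits 2 n)) (sym eq))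

binaryOnes-even : ∀ n → binaryOnes (n * 2) ≡ binaryOnes n
binaryOnes-even n = binaryOnes-fromDigits (n * 2) (0b ∷ proj₁ (toDigits 2 n))
  (cong (_* 2) (proj₂ (toDigits 2 n)))

binaryOnes-odd : ∀ n → binaryOnes (suc (n * 2)) ≡ suc (binaryOnes n)
binaryOnes-odd n = binaryOnes-fromDigits (suc (n * 2)) (1b ∷ proj₁ (toDigits 2 n))
  (cong (λ k → suc (k * 2)) (proj₂ (toDigits 2 n)))

-1^_ : ℕ → ℤ
-1^ zero  = + 1
-1^ suc n = ℤ.- (-1^ n)

-1^-*2 : ∀ n → -1^ (n * 2) ≡ + 1
-1^-*2 zero    = refl
-1^-*2 (suc n) = cong (λ z → ℤ.- (ℤ.- z)) (-1^-*2 n)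

-1^-even : ∀ {n} → Even n → -1^ n ≡ + 1
-1^-even (divides k refl) = -1^-*2 k

-1^-odd : ∀ {n} → Odd n → -1^ n ≡ ℤ.- (+ 1)
-1^-odd odd with Odd⇒1+*2 odd
... | k , refl = cong ℤ.-_ (-1^-*2 k)

τ : ℕ → ℤ
τ x = -1^ binaryOnes x

τ-even : ∀ y → τ (y * 2) ≡ τ y
τ-even y = cong -1^_ (binaryOnes-even y)

τ-odd : ∀ y → τ (suc (y * 2)) ≡ ℤ.- τ y
τ-odd y = cong -1^_ (binaryOnes-odd y)

-- Weights of period 3

-- Rotating the three values at each successor makes a shift of the argument by one a matter of
-- computation.
period₃ : ℤ → ℤ → ℤ → ℕ → ℤ
period₃ p q r zero    = p
period₃ p q r (suc x) = period₃ q r p x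

-- Doubling fixes the residue 0 mod 3 and exchanges 1 and 2.
period₃-*2 : ∀ p q r y → period₃ p q r (y * 2) ≡ period₃ p r q y
period₃-*2 p q r zero    = refl
period₃-*2 p q r (suc y) = period₃-*2 r p q y

period₃-neg : ∀ p q r y → ℤ.- period₃ p q r y ≡ period₃ (ℤ.- p) (ℤ.- q) (ℤ.- r) y
period₃-neg p q r zero    = refl
period₃-neg p q r (suc y) = period₃-neg q r p y

period₃-+ : ∀ p q r p′ q′ r′ y →
  period₃ p q r y ℤ.+ period₃ p′ q′ r′ y ≡ period₃ (p ℤ.+ p′) (q ℤ.+ q′) (r ℤ.+ r′) y
period₃-+ p q r p′ q′ r′ zero    = refl
period₃-+ p q r p′ q′ r′ (suc y) = period₃-+ q r p q′ r′ p′ y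

period₃-multiple : ∀ {p q r x} → 3 ∣ x → period₃ p q r x ≡ p
period₃-multiple (divides zero    refl) = refl
period₃-multiple (divides (suc k) refl) = period₃-multiple (divides k refl)

period₃-nonmultiple : ∀ {p q x} → 3 ∤ x → period₃ p q q x ≡ q
period₃-nonmultiple {x = 0}                 3∤x = ⊥-elim (3∤x (3 ∣0))
period₃-nonmultiple {x = 1}                 3∤x = refl
period₃-nonmultiple {x = 2}                 3∤x = refl
period₃-nonmultiple {x = suc (suc (suc x))} 3∤x = period₃-nonmultiple {x = x} (3∤x ∘ ∣m∣n⇒∣m+n ∣-refl)

⟨_,_,_⟩ : ℤ → ℤ → ℤ → ℕ → ℤ
⟨ p , q , r ⟩ x = τ x ℤ.* period₃ p q r x

⟨⟩-even : ∀ p q r y → ⟨ p , q , r ⟩ (y * 2) ≡ ⟨ p , r , q ⟩ y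
⟨⟩-even p q r y = cong₂ ℤ._*_ (τ-even y) (period₃-*2 p q r y)

-- The successor rotates the weights to `q , r , p`, the doubling then swaps the last two, and the
-- appended binary digit 1 flips the sign.
⟨⟩-odd : ∀ p q r y → ⟨ p , q , r ⟩ (suc (y * 2)) ≡ ⟨ ℤ.- q , ℤ.- p , ℤ.- r ⟩ y
⟨⟩-odd p q r y = begin
  τ (suc (y * 2)) ℤ.* period₃ q r p (y * 2)  ≡⟨ cong₂ ℤ._*_ (τ-odd y) (period₃-*2 q r p y) ⟩
  ℤ.- τ y ℤ.* period₃ q p r y                ≡⟨ ℤ.neg-distribˡ-* (τ y) _ ⟨
  ℤ.- (τ y ℤ.* period₃ q p r y)              ≡⟨ ℤ.neg-distribʳ-* (τ y) _ ⟩
  τ y ℤ.* ℤ.- period₃ q p r y                ≡⟨ cong (τ y ℤ.*_) (period₃-neg q p r y) ⟩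
  ⟨ ℤ.- q , ℤ.- p , ℤ.- r ⟩ y                ∎

⟨⟩-pair : ∀ p q r y →
  ⟨ p , q , r ⟩ (y * 2) ℤ.+ ⟨ p , q , r ⟩ (suc (y * 2)) ≡ ⟨ p ℤ.- q , r ℤ.- p , q ℤ.- r ⟩ y
⟨⟩-pair p q r y = begin
  ⟨ p , q , r ⟩ (y * 2) ℤ.+ ⟨ p , q , r ⟩ (suc (y * 2))               ≡⟨ cong₂ ℤ._+_ (⟨⟩-even p q r y) (⟨⟩-odd p q r y) ⟩
  ⟨ p , r , q ⟩ y ℤ.+ ⟨ ℤ.- q , ℤ.- p , ℤ.- r ⟩ y                     ≡⟨ ℤ.*-distribˡ-+ (τ y) _ _ ⟨
  τ y ℤ.* (period₃ p r q y ℤ.+ period₃ (ℤ.- q) (ℤ.- p) (ℤ.- r) y)     ≡⟨ cong (τ y ℤ.*_) (period₃-+ p r q _ _ _ y) ⟩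
  ⟨ p ℤ.- q , r ℤ.- p , q ℤ.- r ⟩ y                                   ∎

-- Trailing binary zeros do not affect `τ`, and a power of 2 is 1 or -1 mod 3 according to the
-- parity of its exponent. An odd exponent therefore swaps the last two weights; an even one changes
-- nothing.
⟨⟩-2^-even : ∀ p q r t c → ⟨ p , q , r ⟩ (2 ^ (t * 2) * c) ≡ ⟨ p , q , r ⟩ c
⟨⟩-2^-odd : ∀ p q r t c → ⟨ p , q , r ⟩ (2 ^ suc (t * 2) * c) ≡ ⟨ p , r , q ⟩ c

⟨⟩-2^-even p q r zero    c = cong ⟨ p , q , r ⟩ (*-identityˡ c)
⟨⟩-2^-even p q r (suc t) c = begin
  ⟨ p , q , r ⟩ (2 * 2 ^ suc (t * 2) * c)  ≡⟨ cong ⟨ p , q , r ⟩ (2*m*n≡m*n*2 (2 ^ suc (t * 2)) c) ⟩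
  ⟨ p , q , r ⟩ (2 ^ suc (t * 2) * c * 2)  ≡⟨ ⟨⟩-even p q r (2 ^ suc (t * 2) * c) ⟩
  ⟨ p , r , q ⟩ (2 ^ suc (t * 2) * c)      ≡⟨ ⟨⟩-2^-odd p r q t c ⟩
  ⟨ p , q , r ⟩ c                          ∎

⟨⟩-2^-odd p q r t c = begin
  ⟨ p , q , r ⟩ (2 * 2 ^ (t * 2) * c)  ≡⟨ cong ⟨ p , q , r ⟩ (2*m*n≡m*n*2 (2 ^ (t * 2)) c) ⟩
  ⟨ p , q , r ⟩ (2 ^ (t * 2) * c * 2)  ≡⟨ ⟨⟩-even p q r (2 ^ (t * 2) * c) ⟩
  ⟨ p , r , q ⟩ (2 ^ (t * 2) * c)      ≡⟨ ⟨⟩-2^-even p r q t c ⟩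
  ⟨ p , r , q ⟩ c                      ∎

-- Intervals and sums over them

iterate-suc-++ : ∀ a k n → iterate suc a (k + n) ≡ iterate suc a k ++ iterate suc (a + k) n
iterate-suc-++ a zero    n = cong (λ b → iterate suc b n) (sym (+-identityʳ a))
iterate-suc-++ a (suc k) n = cong (a ∷_) (trans (iterate-suc-++ (suc a) k n)
  (cong (λ b → iterate suc (suc a) k ++ iterate suc b n) (sym (+-suc a k))))

-- Only `f = id` is wanted, but `applyUpTo` recurs on `f ∘ suc`, so the induction runs over all `f`
-- commuting with `suc`.
applyUpTo≡iterate-suc : ∀ (f : ℕ → ℕ) → (∀ x → f (suc x) ≡ suc (f x)) →
  ∀ n → applyUpTo f n ≡ iterate suc (f 0) n
applyUpTo≡iterate-suc f f-suc zero    = refl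
applyUpTo≡iterate-suc f f-suc (suc n) = cong (f 0 ∷_)
  (trans (applyUpTo≡iterate-suc (f ∘ suc) (f-suc ∘ suc) n) (cong (λ b → iterate suc b n) (f-suc 0)))

iterate-suc-≥ : ∀ {a} b n → a ≤ b → All (a ≤_) (iterate suc b n)
iterate-suc-≥ b zero    a≤b = []
iterate-suc-≥ b (suc n) a≤b = a≤b ∷ iterate-suc-≥ (suc b) n (m≤n⇒m≤1+n a≤b)

iterate-suc-≱ : ∀ {a} b n → b + n ≤ a → All (λ x → a ≰ x) (iterate suc b n)
iterate-suc-≱ b zero    _     = []
iterate-suc-≱ {a} b (suc n) b+n<a =
  <⇒≱ (≤-trans (m≤m+n (suc b) n) 1+b+n≤a) ∷ iterate-suc-≱ (suc b) n 1+b+n≤a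
  where
  1+b+n≤a : suc b + n ≤ a
  1+b+n≤a = subst (_≤ a) (+-suc b n) b+n<a

interval≡iterate-suc : ∀ a n → [ a , a + n ⟩ ≡ iterate suc a n
interval≡iterate-suc a n = begin
  filter (a ≤?_) (upTo (a + n))                       ≡⟨ cong (filter (a ≤?_)) (applyUpTo≡iterate-suc id (λ _ → refl) (a + n)) ⟩
  filter (a ≤?_) (iterate suc 0 (a + n))              ≡⟨ cong (filter (a ≤?_)) (iterate-suc-++ 0 a n) ⟩
  filter (a ≤?_) (iterate suc 0 a ++ iterate suc a n) ≡⟨ filter-++ (a ≤?_) (iterate suc 0 a) (iterate suc a n) ⟩
  filter (a ≤?_) (iterate suc 0 a) ++ filter (a ≤?_) (iterate suc a n)
    ≡⟨ cong₂ _++_ (filter-none (a ≤?_) (iterate-suc-≱ 0 a ≤-refl)) (filter-all (a ≤?_) (iterate-suc-≥ a n ≤-refl)) ⟩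
  iterate suc a n                                     ∎

∑ : (ℕ → ℤ) → List ℕ → ℤ
∑ f []       = + 0
∑ f (x ∷ xs) = f x ℤ.+ ∑ f xs

-- By computation the list on the left begins with `a * 2` and `suc (a * 2)` and continues from
-- `suc a * 2`, so each step of the induction consumes one pair.
∑-*2 : ∀ f g → (∀ y → f (y * 2) ℤ.+ f (suc (y * 2)) ≡ g y) →
  ∀ a n → ∑ f (iterate suc (a * 2) (n * 2)) ≡ ∑ g (iterate suc a n)
∑-*2 f g f≡g a zero    = refl
∑-*2 f g f≡g a (suc n) = trans (sym (ℤ.+-assoc (f (a * 2)) (f (suc (a * 2))) _))
  (cong₂ ℤ._+_ (f≡g a) (∑-*2 f g f≡g (suc a) n))

-- The difference of counts as a signed sum

module _ {P : Pred ℕ 0ℓ} (P? : Decidable P) where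

  count : List ℕ → ℕ
  count xs = length (filter P? xs)

  count-++ : ∀ xs ys → count (xs ++ ys) ≡ count xs + count ys
  count-++ xs ys = trans (cong length (filter-++ P? xs ys)) (length-++ (filter P? xs))

  count-accept : ∀ {x} → P x → count (x ∷ []) ≡ 1
  count-accept px = cong length (filter-accept P? px)

  count-reject : ∀ {x} → ¬ P x → count (x ∷ []) ≡ 0
  count-reject ¬px = cong length (filter-reject P? ¬px)

Δ≡ : ∀ xs {e o} → count oddEvil₃? xs ≡ e → count oddOdious₃? xs ≡ o → Δ₃ᵒᵈᵈ xs ≡ + e ℤ.- + o
Δ≡ xs = cong₂ (λ e o → + e ℤ.- + o)

Δ-++ : ∀ xs ys → Δ₃ᵒᵈᵈ (xs ++ ys) ≡ Δ₃ᵒᵈᵈ xs ℤ.+ Δ₃ᵒᵈᵈ ys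
Δ-++ xs ys = trans (Δ≡ (xs ++ ys) (count-++ oddEvil₃? xs ys) (count-++ oddOdious₃? xs ys))
  (interchange (+ count oddEvil₃? xs) (+ count oddEvil₃? ys) (+ count oddOdious₃? xs) (+ count oddOdious₃? ys))
  where
  interchange : ∀ a b c d → (a ℤ.+ b) ℤ.- (c ℤ.+ d) ≡ (a ℤ.- c) ℤ.+ (b ℤ.- d)
  interchange = solve-∀

Δ≡∑ : ∀ xs → Δ₃ᵒᵈᵈ xs ≡ ∑ (λ x → Δ₃ᵒᵈᵈ (x ∷ [])) xs
Δ≡∑ []       = refl
Δ≡∑ (x ∷ xs) = trans (Δ-++ (x ∷ []) xs) (cong (λ z → Δ₃ᵒᵈᵈ (x ∷ []) ℤ.+ z) (Δ≡∑ xs))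

Δ-singleton-even : ∀ {x} → Even x → Δ₃ᵒᵈᵈ (x ∷ []) ≡ + 0
Δ-singleton-even {x} even =
  Δ≡ (x ∷ []) (count-reject oddEvil₃? {x} (λ (odd , _) → odd even)) (count-reject oddOdious₃? {x} (λ (odd , _) → odd even))

-- The weight `⟨ + 1 , + 0 , + 0 ⟩` is `τ` cut down to the multiples of 3, and `τ` is 1 on evil and
-- -1 on odious numbers.
Δ-singleton-odd : ∀ {x} → Odd x → Δ₃ᵒᵈᵈ (x ∷ []) ≡ ⟨ + 1 , + 0 , + 0 ⟩ x
Δ-singleton-odd {x} odd = by-cases (3 ∣? x) (evil? x)
  where
  by-cases : Dec (3 ∣ x) → Dec (Evil x) → Δ₃ᵒᵈᵈ (x ∷ []) ≡ ⟨ + 1 , + 0 , + 0 ⟩ x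
  by-cases (no 3∤x) _ = begin
    Δ₃ᵒᵈᵈ (x ∷ [])           ≡⟨ Δ≡ (x ∷ []) (count-reject oddEvil₃? {x} (λ (_ , _ , 3∣x) → 3∤x 3∣x))
                                            (count-reject oddOdious₃? {x} (λ (_ , _ , 3∣x) → 3∤x 3∣x)) ⟩
    + 0                      ≡⟨ ℤ.*-zeroʳ (τ x) ⟨
    τ x ℤ.* + 0              ≡⟨ cong (τ x ℤ.*_) (period₃-nonmultiple 3∤x) ⟨
    ⟨ + 1 , + 0 , + 0 ⟩ x    ∎
  by-cases (yes 3∣x) (yes evil) = begin
    Δ₃ᵒᵈᵈ (x ∷ [])           ≡⟨ Δ≡ (x ∷ []) (count-accept oddEvil₃? (odd , evil , 3∣x))
                                            (count-reject oddOdious₃? {x} (λ (_ , odious , _) → odious evil)) ⟩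
    + 1 ℤ.* + 1              ≡⟨ cong₂ ℤ._*_ (-1^-even evil) (period₃-multiple 3∣x) ⟨
    ⟨ + 1 , + 0 , + 0 ⟩ x    ∎
  by-cases (yes 3∣x) (no odious) = begin
    Δ₃ᵒᵈᵈ (x ∷ [])           ≡⟨ Δ≡ (x ∷ []) (count-reject oddEvil₃? {x} (λ (_ , evil , _) → odious evil))
                                            (count-accept oddOdious₃? (odd , odious , 3∣x)) ⟩
    ℤ.- + 1 ℤ.* + 1          ≡⟨ cong₂ ℤ._*_ (-1^-odd odious) (period₃-multiple 3∣x) ⟨
    ⟨ + 1 , + 0 , + 0 ⟩ x    ∎

-- The even member contributes nothing. The odd member 2y+1 is a multiple of 3 exactly when y is 1
-- mod 3, and its sign is opposite to that of y: hence the -1 in the middle.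
Δ-pair : ∀ y → Δ₃ᵒᵈᵈ (y * 2 ∷ []) ℤ.+ Δ₃ᵒᵈᵈ (suc (y * 2) ∷ []) ≡ ⟨ + 0 , ℤ.- + 1 , + 0 ⟩ y
Δ-pair y = begin
  Δ₃ᵒᵈᵈ (y * 2 ∷ []) ℤ.+ Δ₃ᵒᵈᵈ (suc (y * 2) ∷ [])  ≡⟨ cong₂ ℤ._+_ (Δ-singleton-even (n∣m*n y)) (Δ-singleton-odd (odd-1+n*2 y)) ⟩
  + 0 ℤ.+ ⟨ + 1 , + 0 , + 0 ⟩ (suc (y * 2))        ≡⟨ ℤ.+-identityˡ _ ⟩
  ⟨ + 1 , + 0 , + 0 ⟩ (suc (y * 2))                ≡⟨ ⟨⟩-odd (+ 1) (+ 0) (+ 0) y ⟩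
  ⟨ + 0 , ℤ.- + 1 , + 0 ⟩ y                        ∎

-- Dyadic blocks

block : ℕ → ℕ → List ℕ
block m a = iterate suc (2 ^ m * a) (2 ^ m)

∑-block-suc : ∀ f g → (∀ y → f (y * 2) ℤ.+ f (suc (y * 2)) ≡ g y) →
  ∀ m a → ∑ f (block (suc m) a) ≡ ∑ g (block m a)
∑-block-suc f g f≡g m a = begin
  ∑ f (iterate suc (2 * 2 ^ m * a) (2 * 2 ^ m))
    ≡⟨ cong₂ (λ b n → ∑ f (iterate suc b n)) (2*m*n≡m*n*2 (2 ^ m) a) (*-comm 2 (2 ^ m)) ⟩
  ∑ f (iterate suc (2 ^ m * a * 2) (2 ^ m * 2))
    ≡⟨ ∑-*2 f g f≡g (2 ^ m * a) (2 ^ m) ⟩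
  ∑ g (block m a) ∎

∑-block-zero : ∀ f a → ∑ f (block 0 a) ≡ f a
∑-block-zero f a = trans (ℤ.+-identityʳ _) (cong f (*-identityˡ a))

⟨⟩-cong : ∀ {p q r p′ q′ r′} → p ≡ p′ → q ≡ q′ → r ≡ r′ → ∀ y → ⟨ p , q , r ⟩ y ≡ ⟨ p′ , q′ , r′ ⟩ y
⟨⟩-cong refl refl refl y = refl

-- Up to scale, the two weights between which halving alternates. The names record whether an even
-- or an odd number of halvings leads from `Δ₃ᵒᵈᵈ` to them.
evenWeight oddWeight : ℤ → ℕ → ℤ
evenWeight c = ⟨ c , + 0 , ℤ.- c ⟩
oddWeight  c = ⟨ c , ℤ.- (+ 2 ℤ.* c) , c ⟩

evenWeight-pair : ∀ c y → evenWeight c (y * 2) ℤ.+ evenWeight c (suc (y * 2)) ≡ oddWeight c y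
evenWeight-pair c y = trans (⟨⟩-pair c (+ 0) (ℤ.- c) y) (⟨⟩-cong (e₁ c) (e₂ c) (e₃ c) y)
  where
  e₁ : ∀ c → c ℤ.- + 0 ≡ c
  e₁ = solve-∀
  e₂ : ∀ c → ℤ.- c ℤ.- c ≡ ℤ.- (+ 2 ℤ.* c)
  e₂ = solve-∀
  e₃ : ∀ c → + 0 ℤ.- ℤ.- c ≡ c
  e₃ = solve-∀

oddWeight-pair : ∀ c y → oddWeight c (y * 2) ℤ.+ oddWeight c (suc (y * 2)) ≡ evenWeight (+ 3 ℤ.* c) y
oddWeight-pair c y = trans (⟨⟩-pair c (ℤ.- (+ 2 ℤ.* c)) c y) (⟨⟩-cong (e₁ c) (e₂ c) (e₃ c) y)
  where
  e₁ : ∀ c → c ℤ.- ℤ.- (+ 2 ℤ.* c) ≡ + 3 ℤ.* c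
  e₁ = solve-∀
  e₂ : ∀ c → c ℤ.- c ≡ + 0
  e₂ = solve-∀
  e₃ : ∀ c → ℤ.- (+ 2 ℤ.* c) ℤ.- c ≡ ℤ.- (+ 3 ℤ.* c)
  e₃ = solve-∀

-- Two halvings restore the shape of the weight and triple its scale, so `c` varies in the
-- induction. The `e` halvings left over are later 0 or 1, by the parity of the block exponent.
∑-evenWeight : ∀ k e c a →
  ∑ (evenWeight (+ c)) (block (k * 2 + e) a) ≡ ∑ (evenWeight (+ (3 ^ k * c))) (block e a)
∑-evenWeight zero    e c a = cong (λ z → ∑ (evenWeight (+ z)) (block e a)) (sym (*-identityˡ c))
∑-evenWeight (suc k) e c a = begin
  ∑ (evenWeight (+ c)) (block (2 + (k * 2 + e)) a)        ≡⟨ ∑-block-suc _ _ (evenWeight-pair (+ c)) (1 + (k * 2 + e)) a ⟩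
  ∑ (oddWeight (+ c)) (block (1 + (k * 2 + e)) a)         ≡⟨ ∑-block-suc _ _ (oddWeight-pair (+ c)) (k * 2 + e) a ⟩
  ∑ (evenWeight (+ 3 ℤ.* + c)) (block (k * 2 + e) a)      ≡⟨ cong (λ z → ∑ (evenWeight z) (block (k * 2 + e) a)) (ℤ.pos-* 3 c) ⟨
  ∑ (evenWeight (+ (3 * c))) (block (k * 2 + e) a)        ≡⟨ ∑-evenWeight k e (3 * c) a ⟩
  ∑ (evenWeight (+ (3 ^ k * (3 * c)))) (block e a)        ≡⟨ cong (λ z → ∑ (evenWeight (+ z)) (block e a)) 3^k*[3*c] ⟩
  ∑ (evenWeight (+ (3 ^ suc k * c))) (block e a)          ∎
  where
  3^k*[3*c] : 3 ^ k * (3 * c) ≡ 3 ^ suc k * c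
  3^k*[3*c] = trans (sym (*-assoc (3 ^ k) 3 c)) (cong (_* c) (*-comm (3 ^ k) 3))

Δ-block : ∀ k e a → Δ₃ᵒᵈᵈ (block (2 + (k * 2 + e)) a) ≡ ∑ (evenWeight (+ (3 ^ k))) (block e a)
Δ-block k e a = begin
  Δ₃ᵒᵈᵈ (block (2 + (k * 2 + e)) a)                        ≡⟨ Δ≡∑ (block (2 + (k * 2 + e)) a) ⟩
  ∑ (λ x → Δ₃ᵒᵈᵈ (x ∷ [])) (block (2 + (k * 2 + e)) a)     ≡⟨ ∑-block-suc _ _ Δ-pair (1 + (k * 2 + e)) a ⟩
  -- The differences formed by `⟨⟩-pair` are closed integers here and compute to the entries 1, 0,
  -- -1 of `evenWeight (+ 1)`.
  ∑ ⟨ + 0 , ℤ.- + 1 , + 0 ⟩ (block (1 + (k * 2 + e)) a)    ≡⟨ ∑-block-suc _ _ (⟨⟩-pair (+ 0) (ℤ.- + 1) (+ 0)) (k * 2 + e) a ⟩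
  ∑ (evenWeight (+ 1)) (block (k * 2 + e) a)               ≡⟨ ∑-evenWeight k e 1 a ⟩
  ∑ (evenWeight (+ (3 ^ k * 1))) (block e a)               ≡⟨ cong (λ z → ∑ (evenWeight (+ z)) (block e a)) (*-identityʳ (3 ^ k)) ⟩
  ∑ (evenWeight (+ (3 ^ k))) (block e a)                   ∎

Δ-block-even : ∀ k a → Δ₃ᵒᵈᵈ (block (2 + k * 2) a) ≡ evenWeight (+ (3 ^ k)) a
Δ-block-even k a = begin
  Δ₃ᵒᵈᵈ (block (2 + k * 2) a)             ≡⟨ cong (λ m → Δ₃ᵒᵈᵈ (block (2 + m) a)) (+-identityʳ (k * 2)) ⟨
  Δ₃ᵒᵈᵈ (block (2 + (k * 2 + 0)) a)       ≡⟨ Δ-block k 0 a ⟩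
  ∑ (evenWeight (+ (3 ^ k))) (block 0 a)  ≡⟨ ∑-block-zero (evenWeight (+ (3 ^ k))) a ⟩
  evenWeight (+ (3 ^ k)) a                ∎

Δ-block-odd : ∀ k a → Δ₃ᵒᵈᵈ (block (3 + k * 2) a) ≡ oddWeight (+ (3 ^ k)) a
Δ-block-odd k a = begin
  Δ₃ᵒᵈᵈ (block (3 + k * 2) a)             ≡⟨ cong (λ m → Δ₃ᵒᵈᵈ (block (2 + m) a)) (+-comm (k * 2) 1) ⟨
  Δ₃ᵒᵈᵈ (block (2 + (k * 2 + 1)) a)       ≡⟨ Δ-block k 1 a ⟩
  ∑ (evenWeight (+ (3 ^ k))) (block 1 a)  ≡⟨ ∑-block-suc (evenWeight (+ (3 ^ k))) (oddWeight (+ (3 ^ k))) (evenWeight-pair (+ (3 ^ k))) 0 a ⟩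
  ∑ (oddWeight (+ (3 ^ k))) (block 0 a)   ≡⟨ ∑-block-zero (oddWeight (+ (3 ^ k))) a ⟩
  oddWeight (+ (3 ^ k)) a                 ∎

Δ-block-even′ : ∀ {m} → Even m → 2 ≤ m → ∀ a → Δ₃ᵒᵈᵈ (block m a) ≡ evenWeight (+ (3 ^ ((m ∸ 2) / 2))) a
Δ-block-even′ (divides zero    refl) ()
Δ-block-even′ (divides (suc k) refl) _ a = trans (Δ-block-even k a)
  (cong (λ z → evenWeight (+ (3 ^ z)) a) (sym (m*n/n≡m k 2)))

Δ-block-odd′ : ∀ {m} → Odd m → 3 ≤ m → ∀ a → Δ₃ᵒᵈᵈ (block m a) ≡ oddWeight (+ (3 ^ ((m ∸ 3) / 2))) a
Δ-block-odd′ om 3≤m a with Odd⇒1+*2 om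
Δ-block-odd′ om (s≤s ()) a | zero  , refl
Δ-block-odd′ om 3≤m      a | suc k , refl = trans (Δ-block-odd k a)
  (cong (λ z → oddWeight (+ (3 ^ z)) a) (sym (m*n/n≡m k 2)))

-- Since `n = d + m`, the starting point is a multiple of the length `2 ^ m`, which makes the
-- interval a dyadic block.
Δ-interval : ∀ {n} d m c → n ≡ d + m →
  Δ₃ᵒᵈᵈ [ 2 ^ n * c , 2 ^ n * c + 2 ^ m ⟩ ≡ Δ₃ᵒᵈᵈ (block m (2 ^ d * c))
Δ-interval d m c refl = cong Δ₃ᵒᵈᵈ (trans (interval≡iterate-suc (2 ^ (d + m) * c) (2 ^ m))
  (cong (λ b → iterate suc b (2 ^ m)) (begin
    2 ^ (d + m) * c      ≡⟨ cong (_* c) (^-distribˡ-+-* 2 d m) ⟩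
    2 ^ d * 2 ^ m * c    ≡⟨ cong (_* c) (*-comm (2 ^ d) (2 ^ m)) ⟩
    2 ^ m * 2 ^ d * c    ≡⟨ *-assoc (2 ^ m) (2 ^ d) c ⟩
    2 ^ m * (2 ^ d * c)  ∎)))

-- Intervals from `2 ^ n * c`, by the parities of `n` and `m`

module _ (c : ℕ) {n m : ℕ} where

  private
    I = [ 2 ^ n * c , 2 ^ n * c + 2 ^ m ⟩
    E O : ℤ
    E = + (3 ^ ((m ∸ 2) / 2))
    O = + (3 ^ ((m ∸ 3) / 2))

  -- With `c` left free, the same four cases serve `c = 1` and `c = 5`. The parity of `m` selects
  -- the weight; when `n` has the other parity, the last two entries are swapped.
  Δ-even-even : Even n → Even m → 2 ≤ m → m ≤ n → Δ₃ᵒᵈᵈ I ≡ ⟨ E , + 0 , ℤ.- E ⟩ c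
  Δ-even-even en em 2≤m m≤n = let t , n≡ = even∸even en em m≤n in
    trans (Δ-interval (t * 2) m c n≡) (trans (Δ-block-even′ em 2≤m _) (⟨⟩-2^-even _ _ _ t c))

  Δ-odd-even : Odd n → Even m → 2 ≤ m → m < n → Δ₃ᵒᵈᵈ I ≡ ⟨ E , ℤ.- E , + 0 ⟩ c
  Δ-odd-even on em 2≤m m<n = let t , n≡ = odd∸even on em m<n in
    trans (Δ-interval (suc (t * 2)) m c n≡) (trans (Δ-block-even′ em 2≤m _) (⟨⟩-2^-odd _ _ _ t c))

  Δ-even-odd : Even n → Odd m → 3 ≤ m → m < n → Δ₃ᵒᵈᵈ I ≡ ⟨ O , O , ℤ.- (+ 2 ℤ.* O) ⟩ c
  Δ-even-odd en om 3≤m m<n = let t , n≡ = even∸odd en om m<n in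
    trans (Δ-interval (suc (t * 2)) m c n≡) (trans (Δ-block-odd′ om 3≤m _) (⟨⟩-2^-odd _ _ _ t c))

  Δ-odd-odd : Odd n → Odd m → 3 ≤ m → m ≤ n → Δ₃ᵒᵈᵈ I ≡ ⟨ O , ℤ.- (+ 2 ℤ.* O) , O ⟩ c
  Δ-odd-odd on om 3≤m m≤n = let t , n≡ = odd∸odd on om m≤n in
    trans (Δ-interval (t * 2) m c n≡) (trans (Δ-block-odd′ om 3≤m _) (⟨⟩-2^-even _ _ _ t c))

-- The number 1 is odious and 1 mod 3, so it returns the middle entry negated; 5, binary 101, is
-- evil and 2 mod 3, so it returns the last entry.
⟨⟩-1 : ∀ p q r → ⟨ p , q , r ⟩ 1 ≡ ℤ.- q
⟨⟩-1 p q r = ℤ.-1*i≡-i q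

⟨⟩-5 : ∀ p q r → ⟨ p , q , r ⟩ 5 ≡ r
⟨⟩-5 p q r = ℤ.*-identityˡ r

-- The intervals starting at 2ⁿ, at 2ⁿ + 2ⁿ⁻² and at 0

interval-1 : ∀ n m → [ 2 ^ n , 2 ^ n + 2 ^ m ⟩ ≡ [ 2 ^ n * 1 , 2 ^ n * 1 + 2 ^ m ⟩
interval-1 n m = cong (λ b → [ b , b + 2 ^ m ⟩) (sym (*-identityʳ (2 ^ n)))

interval-5 : ∀ n m → [ 2 ^ (2 + n) + 2 ^ n , 2 ^ (2 + n) + 2 ^ n + 2 ^ m ⟩ ≡ [ 2 ^ n * 5 , 2 ^ n * 5 + 2 ^ m ⟩
interval-5 n m = cong (λ b → [ b , b + 2 ^ m ⟩) (5*x (2 ^ n))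
  where
  5*x : ∀ x → 2 * (2 * x) + x ≡ x * 5
  5*x = ℕ-Solver.solve-∀

⌊n*2/2⌋ : ∀ n → ⌊ n * 2 /2⌋ ≡ n
⌊n*2/2⌋ zero    = refl
⌊n*2/2⌋ (suc n) = cong suc (⌊n*2/2⌋ n)

⌊1+n*2/2⌋ : ∀ n → ⌊ suc (n * 2) /2⌋ ≡ n
⌊1+n*2/2⌋ zero    = refl
⌊1+n*2/2⌋ (suc n) = cong suc (⌊1+n*2/2⌋ n)

-- The interval is the block with `a = 0`. As 0 is evil and divisible by 3, both weights return
-- their first entry `3 ^ k`, whether `n` is `2 + k * 2` or `3 + k * 2`; this is where the floor
-- comes from.
Δ-initial : ∀ n → 2 ≤ n → Δ₃ᵒᵈᵈ [ 0 , 2 ^ n ⟩ ≡ + (3 ^ (⌊ n /2⌋ ∸ 1))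
Δ-initial n 2≤n = trans (cong Δ₃ᵒᵈᵈ (interval≡iterate-suc 0 (2 ^ n)))
  (trans (cong (λ b → Δ₃ᵒᵈᵈ (iterate suc b (2 ^ n))) (sym (*-zeroʳ (2 ^ n)))) (Δ-block-0 n 2≤n))
  where
  Δ-block-0 : ∀ n → 2 ≤ n → Δ₃ᵒᵈᵈ (block n 0) ≡ + (3 ^ (⌊ n /2⌋ ∸ 1))
  Δ-block-0 n 2≤n with parity n
  Δ-block-0 n 2≤n      | inj₁ (suc k , refl) = trans (Δ-block-even k 0)
    (trans (ℤ.*-identityˡ _) (cong (λ z → + (3 ^ z)) (sym (⌊n*2/2⌋ k))))
  Δ-block-0 n (s≤s ()) | inj₂ (zero  , refl)
  Δ-block-0 n 2≤n      | inj₂ (suc k , refl) = trans (Δ-block-odd k 0)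
    (trans (ℤ.*-identityˡ _) (cong (λ z → + (3 ^ z)) (sym (⌊1+n*2/2⌋ k))))

m+1+k≤n⇒m<n : ∀ {m n} k → m + suc k ≤ n → m < n
m+1+k≤n⇒m<n {m} {n} k le = m+n≤o⇒m≤o (suc m) (subst (_≤ n) (+-suc m k) le)

m+2+k≤2+n⇒m+k≤n : ∀ {m n} k → m + (2 + k) ≤ 2 + n → m + k ≤ n
m+2+k≤2+n⇒m+k≤n {m} {n} k le = s≤s⁻¹ (s≤s⁻¹ (subst (_≤ 2 + n) (trans (+-suc m (suc k)) (cong suc (+-suc m k))) le))

-- The start 2ⁿ + 2ⁿ⁻² equals 5·2ⁿ⁻², so the case `c = 5` is applied with `n` lowered by 2. This
-- keeps the parity, for which `P` stands, and takes 2 off the gap required between `m` and `n`.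
Δ-interval-5 : ∀ {k m} (P : ℕ → Set) (z : ℤ) → (∀ {n} → P (2 + n) → P n) → 2 ≤ m →
  (∀ {n} → P n → m + k ≤ n → Δ₃ᵒᵈᵈ [ 2 ^ n * 5 , 2 ^ n * 5 + 2 ^ m ⟩ ≡ z) →
  ∀ {n} → P n → m + (2 + k) ≤ n → Δ₃ᵒᵈᵈ [ 2 ^ n + 2 ^ (n ∸ 2) , 2 ^ n + 2 ^ (n ∸ 2) + 2 ^ m ⟩ ≡ z
Δ-interval-5 {k} {m} P z P⁻ 2≤m h pn le = go (≤-trans 2≤m (m+n≤o⇒m≤o m le)) pn le
  where
  go : ∀ {n} → 2 ≤ n → P n → m + (2 + k) ≤ n →
    Δ₃ᵒᵈᵈ [ 2 ^ n + 2 ^ (n ∸ 2) , 2 ^ n + 2 ^ (n ∸ 2) + 2 ^ m ⟩ ≡ z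
  -- Matching on `2 ≤ n` exposes two successors, so that `n ∸ 2` computes without truncation.
  go (s≤s (s≤s {n = n} _)) pn le = trans (cong Δ₃ᵒᵈᵈ (interval-5 n m)) (h (P⁻ pn) (m+2+k≤2+n⇒m+k≤n k le))

theorem2 : (∀ (n : ℕ) → 2 ≤ n → Δ₃ᵒᵈᵈ [ 0 , 2 ^ n ⟩ ≡ + (3 ^ (⌊ n /2⌋ ∸ 1)))
    × (∀ (n m : ℕ) →
    (Even n → Even m → 2 ≤ m → m + 2 ≤ n → Δ₃ᵒᵈᵈ [ 2 ^ n , 2 ^ n + 2 ^ m ⟩ ≡ + 0)
    × (Odd n → Even m → 2 ≤ m → m + 1 ≤ n → Δ₃ᵒᵈᵈ [ 2 ^ n , 2 ^ n + 2 ^ m ⟩ ≡ + (3 ^ ((m ∸ 2) / 2)))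
    × (Even n → Odd m → 3 ≤ m → m + 1 ≤ n → Δ₃ᵒᵈᵈ [ 2 ^ n , 2 ^ n + 2 ^ m ⟩ ≡ ℤ.- (+ (3 ^ ((m ∸ 3) / 2))))
    × (Odd n → Odd m → 3 ≤ m → m + 2 ≤ n → Δ₃ᵒᵈᵈ [ 2 ^ n , 2 ^ n + 2 ^ m ⟩ ≡ + (2 * 3 ^ ((m ∸ 3) / 2))))
    × (∀ (n m : ℕ) →
    (Even n → Even m → 2 ≤ m → m + 4 ≤ n → Δ₃ᵒᵈᵈ [ 2 ^ n + 2 ^ (n ∸ 2) , 2 ^ n + 2 ^ (n ∸ 2) + 2 ^ m ⟩ ≡ ℤ.- (+ (3 ^ ((m ∸ 2) / 2))))
    × (Odd n → Even m → 2 ≤ m → m + 3 ≤ n → Δ₃ᵒᵈᵈ [ 2 ^ n + 2 ^ (n ∸ 2) , 2 ^ n + 2 ^ (n ∸ 2) + 2 ^ m ⟩ ≡ + 0)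
    × (Even n → Odd m → 3 ≤ m → m + 3 ≤ n → Δ₃ᵒᵈᵈ [ 2 ^ n + 2 ^ (n ∸ 2) , 2 ^ n + 2 ^ (n ∸ 2) + 2 ^ m ⟩ ≡ ℤ.- (+ (2 * 3 ^ ((m ∸ 3) / 2))))
    × (Odd n → Odd m → 3 ≤ m → m + 4 ≤ n → Δ₃ᵒᵈᵈ [ 2 ^ n + 2 ^ (n ∸ 2) , 2 ^ n + 2 ^ (n ∸ 2) + 2 ^ m ⟩ ≡ + (3 ^ ((m ∸ 3) / 2))))
theorem2 =
    Δ-initial
  , (λ n m → let E = + (3 ^ ((m ∸ 2) / 2)); o = 3 ^ ((m ∸ 3) / 2); O = + o; -2O = ℤ.- (+ 2 ℤ.* O) in
        (λ en em 2≤m le → at-1 n m E (+ 0) (ℤ.- E) (Δ-even-even 1 en em 2≤m (m+n≤o⇒m≤o m le)))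
      -- The odd gap moves `ℤ.- E` to the middle, and the negative sign of 1 cancels its minus.
      , (λ on em 2≤m le → trans (at-1 n m E (ℤ.- E) (+ 0) (Δ-odd-even 1 on em 2≤m (m+1+k≤n⇒m<n 0 le)))
          (ℤ.neg-involutive E))
      , (λ en om 3≤m le → at-1 n m O O -2O (Δ-even-odd 1 en om 3≤m (m+1+k≤n⇒m<n 0 le)))
      , (λ on om 3≤m le → trans (at-1 n m O -2O O (Δ-odd-odd 1 on om 3≤m (m+n≤o⇒m≤o m le)))
          (trans (ℤ.neg-involutive (+ 2 ℤ.* O)) (sym (ℤ.pos-* 2 o)))))
  , (λ n m → let E = + (3 ^ ((m ∸ 2) / 2)); o = 3 ^ ((m ∸ 3) / 2); O = + o; -2O = ℤ.- (+ 2 ℤ.* O) in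
        -- Here `k` is 2: the bound `m + 4 ≤ n` becomes `m + 2 ≤ n` for the lowered `n`.
        (λ en em 2≤m → Δ-interval-5 Even (ℤ.- E) Even-2+⁻ 2≤m
          (λ en le → trans (Δ-even-even 5 en em 2≤m (m+n≤o⇒m≤o m le)) (⟨⟩-5 E (+ 0) (ℤ.- E))) en)
      , (λ on em 2≤m → Δ-interval-5 Odd (+ 0) Odd-2+⁻ 2≤m
          (λ on le → trans (Δ-odd-even 5 on em 2≤m (m+1+k≤n⇒m<n 0 le)) (⟨⟩-5 E (ℤ.- E) (+ 0))) on)
      , (λ en om 3≤m → Δ-interval-5 Even (ℤ.- (+ (2 * o))) Even-2+⁻ (<⇒≤ 3≤m)
          (λ en le → trans (Δ-even-odd 5 en om 3≤m (m+1+k≤n⇒m<n 0 le))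
            (trans (⟨⟩-5 O O -2O) (cong ℤ.-_ (sym (ℤ.pos-* 2 o))))) en)
      , (λ on om 3≤m → Δ-interval-5 Odd O Odd-2+⁻ (<⇒≤ 3≤m)
          (λ on le → trans (Δ-odd-odd 5 on om 3≤m (m+n≤o⇒m≤o m le)) (⟨⟩-5 O -2O O)) on))
  where
  at-1 : ∀ n m p q r → Δ₃ᵒᵈᵈ [ 2 ^ n * 1 , 2 ^ n * 1 + 2 ^ m ⟩ ≡ ⟨ p , q , r ⟩ 1 →
    Δ₃ᵒᵈᵈ [ 2 ^ n , 2 ^ n + 2 ^ m ⟩ ≡ ℤ.- q
  at-1 n m p q r eq = trans (cong Δ₃ᵒᵈᵈ (interval-1 n m)) (trans eq (⟨⟩-1 p q r))
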